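{- Let $n,m,\delta$ be integers with $\delta \geq n$ and $\delta \geq (m+2)/2$. Then every hypergraph with $n$ vertices, $m$ edges and minimum degree at least $\delta$ is super-pancyclic.
   Context: A hypergraph $\mathcal{H}$ consists of a vertex set $V(\mathcal{H})$ and an edge set $E(\mathcal{H})$ of subsets of $V(\mathcal{H})$; the degree of a vertex is the number of edges containing it. A Berge cycle of length $\ell$ consists of $\ell$ distinct vertices $v_1,\dots,v_\ell$ (its base vertices) and $\ell$ distinct edges $e_1,\dots,e_\ell$ with $v_i,v_{i+1}\in e_i$ (indices mod $\ell$). $\mathcal{H}$ is super-pancyclic if for every $A \subseteq V(\mathcal{H})$ with $|A|\geq 3$, $\mathcal{H}$ has a Berge cycle whose set of base vertices is exactly $A$. -}

module Defs where

open import Data.Fin.Base using (Fin; toℕ)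
open import Data.Fin.Subset using (Subset; _∈_; ∣_∣)
open import Data.Fin.Subset.Properties using (_∈?_)
open import Data.Nat.Base using (ℕ; suc; _≤_)
open import Data.Nat.DivMod using (_mod_)
open import Data.Product.Base using (∃-syntax; Σ-syntax)
open import Data.Vec.Base using (Vec; count)
import Data.Vec.Membership.Propositional as Vec
open import Data.Vec.Relation.Unary.Unique.Propositional using (Unique)
open import Function.Bundles using (_⇔_)
open import Function.Definitions using (Injective)
open import Relation.Binary.PropositionalEquality using (_≡_)

-- The edges form a set of subsets: repetitions are excluded by `distinct`,
-- so m is the number of edges; the order of the listing plays no role.
-- Empty and singleton edges are allowed.
record Hypergraph (n m : ℕ) : Set where
  field
    edges    : Vec (Subset n) m
    distinct : Unique edges

  Edge : Subset n → Set
  Edge e = e Vec.∈ edges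

  degree : Fin n → ℕ
  degree v = count (v ∈?_) edges

open Hypergraph public

MinDegree≥ : ∀ {n m} → Hypergraph n m → ℕ → Set
MinDegree≥ H δ = ∀ v → δ ≤ degree H v

-- i ↦ i + 1 mod ℓ
next : ∀ {ℓ} → Fin ℓ → Fin ℓ
next {suc k} i = suc (toℕ i) mod suc k

record BergeCycle {n m} (H : Hypergraph n m) (ℓ : ℕ) : Set where
  field
    vertex           : Fin ℓ → Fin n
    edge             : Fin ℓ → Subset n
    edge∈H           : ∀ i → Edge H (edge i)
    vertex-injective : Injective _≡_ _≡_ vertex
    edge-injective   : Injective _≡_ _≡_ edge
    vertex∈edge      : ∀ i → vertex i ∈ edge i
    next∈edge        : ∀ i → vertex (next i) ∈ edge i

  HasBaseSet : Subset n → Set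
  HasBaseSet A = ∀ x → x ∈ A ⇔ (∃[ i ] vertex i ≡ x)

SuperPancyclic : ∀ {n m} → Hypergraph n m → Set
SuperPancyclic {n} H = (A : Subset n) → 3 ≤ ∣ A ∣ →
  ∃[ ℓ ] Σ[ C ∈ BergeCycle H ℓ ] BergeCycle.HasBaseSet C A

{-# OPTIONS --safe #-}
module Submission where

open import Data.Bool.Base using (true; false)
import Data.Bool.Properties as Bool
open import Data.Fin.Base using (Fin; zero; suc; toℕ)
open import Data.Fin.Properties using (toℕ-injective; toℕ-fromℕ<; toℕ<n)
open import Data.Fin.Subset using (Subset; ∣_∣; Nonempty) renaming (_∈_ to _∈ₛ_)
import Data.Fin.Subset.Properties as Subset
open import Data.List.Base using (List; []; _∷_; _++_; map; length; filter; lookup; allFin)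
open import Data.List.Membership.Propositional using (_∈_; _∉_; find; lose)
import Data.List.Membership.DecPropositional as DecMembership
open import Data.List.Membership.Propositional.Properties
  using (∈-map⁺; ∈-map⁻; ∈-filter⁺; ∈-filter⁻; ∈-lookup; ∈-allFin; ∈-∃++)
open import Data.List.Properties
  using (map-++; ++-identityʳ; length-map; length-filter; length-tabulate)
open import Data.List.Relation.Binary.Permutation.Propositional
  using (_↭_; prep; swap; ↭-refl; ↭-sym; ↭-trans; ↭⇒↭ₛ; module PermutationReasoning)
open import Data.List.Relation.Binary.Permutation.Propositional.Properties
  using (shift; ++-comm; ++⁺ˡ; ↭-length; ∈-resp-↭) renaming (map⁺ to map⁺-↭)
import Data.List.Relation.Binary.Permutation.Setoid.Properties as Permutationₛ
open import Data.List.Relation.Binary.Subset.Propositional using (_⊆_)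
open import Data.List.Relation.Unary.All using ([]; _∷_)
open import Data.List.Relation.Unary.All.Properties using (¬Any⇒All¬)
open import Data.List.Relation.Unary.AllPairs using ([]; _∷_)
open import Data.List.Relation.Unary.Any using (here; there; any?; index)
open import Data.List.Relation.Unary.Any.Properties using (lookup-index)
open import Data.List.Relation.Unary.Unique.Propositional using (Unique)
open import Data.List.Relation.Unary.Unique.Propositional.Properties
  using (filter⁺; allFin⁺; Unique[x∷xs]⇒x∉xs)
open import Data.Nat.Base using (ℕ; zero; suc; _+_; _*_; _≥_; _≤_; _<_; z≤n; s≤s)
open import Data.Nat.DivMod using (_%_; m<n⇒m%n≡m; n%n≡0)
open import Data.Nat.Properties
  using (≤-trans; ≤-reflexive; +-suc; +-comm; +-identityʳ; +-mono-≤; suc-injective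
        ; m≤n⇒m<n∨m≡n; <-≤-trans; <⇒≱; n≤1+n; +-cancelʳ-≤; module ≤-Reasoning)
open import Data.Product.Base using (Σ-syntax; ∃-syntax; _×_; _,_; proj₁; proj₂)
open import Data.Sum.Base using (_⊎_; inj₁; inj₂)
open import Data.Vec.Base as Vec using (Vec; []; _∷_; count)
import Data.Vec.Membership.Propositional.Properties as Vec
import Data.Vec.Properties as Vec
import Data.Vec.Relation.Unary.All.Properties as VecAll
import Data.Vec.Relation.Unary.AllPairs as VecAllPairs
import Data.Vec.Relation.Unary.Unique.Propositional as Vec
open import Function.Base using (id; _∘_)
open import Function.Bundles using (mk⇔)
open import Function.Definitions using (Injective)
open import Relation.Binary.Definitions using (DecidableEquality)
open import Relation.Binary.PropositionalEquality
  using (_≡_; _≢_; refl; sym; trans; cong; subst; setoid)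
open import Relation.Nullary.Decidable using (yes; no; does; ¬?; decidable-stable)
open import Relation.Nullary.Negation using (contradiction)
open import Relation.Unary using (Decidable)
open import Defs

-- Let C be a cycle through p < k vertices xᵢ, with edges yᵢ, and x a new vertex. Each xᵢ has a
-- neighbour off C, so an edge yᵢ incident to x can be rerouted to a neighbour z of xᵢ off C. Two
-- distinct edges incident to x that agree after rerouting yield a cycle through C and x, either by
-- insertion or by crossing. If x is incident to some yᵢ, a coincidence is forced by comparing the
-- at least k rerouted edges of x with the at least k edges at xᵢ, as there are at most 2k − 2 edges.
-- Otherwise, x is inserted by means of two common edges with consecutive vertices of C.

-- Lists without repetition and a pigeonhole principle.

Unique-resp-↭ : {A : Set} {xs ys : List A} → xs ↭ ys → Unique xs → Unique ys
Unique-resp-↭ {A} xs↭ys = Permutationₛ.Unique-resp-↭ (setoid A) (↭⇒↭ₛ xs↭ys)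

∉⇒Unique-∷ : {A : Set} {x : A} {xs : List A} → x ∉ xs → Unique xs → Unique (x ∷ xs)
∉⇒Unique-∷ x∉xs xs! = ¬Any⇒All¬ _ x∉xs ∷ xs!

Unique-map⇒injective : {A B : Set} (f : A → B) (xs : List A) → Unique (map f xs) →
                       Injective _≡_ _≡_ (f ∘ lookup xs)
Unique-map⇒injective f (x ∷ xs) _ {zero} {zero} _ = refl
Unique-map⇒injective f (x ∷ xs) xs! {zero} {suc j} fx≡fy =
  contradiction (subst (_∈ map f xs) (sym fx≡fy) (∈-map⁺ f (∈-lookup j))) (Unique[x∷xs]⇒x∉xs xs!)
Unique-map⇒injective f (x ∷ xs) xs! {suc i} {zero} fx≡fy =
  contradiction (subst (_∈ map f xs) fx≡fy (∈-map⁺ f (∈-lookup i))) (Unique[x∷xs]⇒x∉xs xs!)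
Unique-map⇒injective f (x ∷ xs) (_ ∷ xs!) {suc i} {suc j} fx≡fy =
  cong suc (Unique-map⇒injective f xs xs! fx≡fy)

Unique∧⊆⇒length≤ : {A : Set} {xs ys : List A} → Unique xs → xs ⊆ ys → length xs ≤ length ys
Unique∧⊆⇒length≤ {xs = []} _ _ = z≤n
Unique∧⊆⇒length≤ {xs = x ∷ xs} xs!@(_ ∷ xs!′) xs⊆ys
  with as , bs , refl ← ∈-∃++ (xs⊆ys (here refl)) =
  ≤-trans (s≤s (Unique∧⊆⇒length≤ xs!′ xs⊆as++bs)) (≤-reflexive (sym (↭-length (shift x as bs))))
  where
  xs⊆as++bs : xs ⊆ as ++ bs
  xs⊆as++bs y∈xs with ∈-resp-↭ (shift x as bs) (xs⊆ys (there y∈xs))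
  ... | here refl = contradiction y∈xs (Unique[x∷xs]⇒x∉xs xs!)
  ... | there y∈  = y∈

module _ {A : Set} (_≟_ : DecidableEquality A) where
  open DecMembership _≟_ using (_∈?_; _∉?_)

  length<⇒∃∉ : {xs ys : List A} → Unique xs → length ys < length xs → ∃[ x ] x ∈ xs × x ∉ ys
  length<⇒∃∉ {xs} {ys} xs! ys<xs with any? (_∉? ys) xs
  ... | yes x∉ys = find x∉ys
  ... | no ¬x∉ys = contradiction (Unique∧⊆⇒length≤ xs! xs⊆ys) (<⇒≱ ys<xs)
    where
    xs⊆ys : xs ⊆ ys
    xs⊆ys {x} x∈xs = decidable-stable (x ∈? ys) λ x∉ys → ¬x∉ys (lose x∈xs x∉ys)

  length≤1+length-filter-≢ : (w : A) {xs : List A} → Unique xs →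
                             length xs ≤ suc (length (filter (λ x → ¬? (x ≟ w)) xs))
  length≤1+length-filter-≢ w {xs} xs! = Unique∧⊆⇒length≤ xs! xs⊆
    where
    xs⊆ : xs ⊆ w ∷ filter (λ x → ¬? (x ≟ w)) xs
    xs⊆ {x} x∈xs with x ≟ w
    ... | yes x≡w = here x≡w
    ... | no  x≢w = there (∈-filter⁺ (λ x → ¬? (x ≟ w)) x∈xs x≢w)

  -- Elements of `xs` are treated one by one. A value `z` of `x` either lies in `ys` already or is
  -- added to `ys`, so the sum of the two lengths stays the same. Once `xs` is used up, `ys` would
  -- be a repetition-free part of `E` longer than `E`. A later hit on an added `z` is a coincidence
  -- between two elements of `xs`.
  pigeonhole : (R : A → A → Set) (E : List A) {xs ys : List A} → Unique xs → Unique ys → ys ⊆ E →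
               (∀ {x} → x ∈ xs → ∃[ z ] R x z × z ∈ E) → length E < length xs + length ys →
               (∃[ x ] ∃[ x′ ] ∃[ z ] x ∈ xs × x′ ∈ xs × x ≢ x′ × R x z × R x′ z) ⊎
               (∃[ x ] ∃[ z ] x ∈ xs × z ∈ ys × R x z)
  pigeonhole R E {[]} _ ys! ys⊆E _ E<ys = contradiction (Unique∧⊆⇒length≤ ys! ys⊆E) (<⇒≱ E<ys)
  pigeonhole R E {x ∷ xs} {ys} xs!@(_ ∷ xs!′) ys! ys⊆E R-total E<xs+ys
    with z , Rxz , z∈E ← R-total (here refl) | z ∈? ys
  ... | yes z∈ys = inj₂ (x , z , here refl , z∈ys , Rxz)
  ... | no  z∉ys
    with pigeonhole R E xs!′ (∉⇒Unique-∷ z∉ys ys!)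
           (λ { (here refl) → z∈E ; (there y∈ys) → ys⊆E y∈ys })
           (R-total ∘ there) (subst (length E <_) (sym (+-suc (length xs) (length ys))) E<xs+ys)
  ... | inj₁ (u , v , w , u∈ , v∈ , rest) = inj₁ (u , v , w , there u∈ , there v∈ , rest)
  ... | inj₂ (u , w , u∈ , there w∈ys , Ruw) = inj₂ (u , w , there u∈ , w∈ys , Ruw)
  ... | inj₂ (u , w , u∈ , here refl , Ruw) =
    inj₁ (x , u , z , here refl , there u∈ , (λ { refl → Unique[x∷xs]⇒x∉xs xs! u∈ }) , Rxz , Ruw)

-- Closed walks in an incidence structure, and surgery on them.

module _ {X Y : Set} (N : X → List Y) where

  -- Path a ((x₁ , y₁) ∷ … ∷ (xₗ , yₗ) ∷ []) b is the walk a = x₁ y₁ x₂ y₂ … xₗ yₗ b; it is a cycle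
  -- when a = b, the xᵢ are distinct and the yᵢ are distinct.
  data Path : X → List (X × Y) → X → Set where
    []   : ∀ {a} → Path a [] a
    step : ∀ {a b c y ps} → y ∈ N a → y ∈ N b → Path b ps c → Path a ((a , y) ∷ ps) c

  -- The permutation leaves the order of the vertices free, since insertion and crossing rearrange
  -- them. Their distinctness is a property of `vs`, supplied when a Berge cycle is read off.
  record Cycle (vs : List X) : Set where
    constructor cycle
    field
      {base}    : X
      {steps}   : List (X × Y)
      closed    : Path base steps base
      edges!    : Unique (map proj₂ steps)
      vertices↭ : map proj₁ steps ↭ vs

module _ {X Y : Set} {N : X → List Y} where

  relabel : ∀ x {vs ws} → vs ↭ ws → Cycle N (x ∷ vs) → Cycle N (x ∷ ws)
  relabel x vs↭ws (cycle closed edges! vertices↭) =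
    cycle closed edges! (↭-trans vertices↭ (prep x vs↭ws))

  infixr 5 _++ᴾ_
  _++ᴾ_ : ∀ {a b c ps qs} → Path N a ps b → Path N b qs c → Path N a (ps ++ qs) c
  []           ++ᴾ q = q
  step y∈ y∈′ p ++ᴾ q = step y∈ y∈′ (p ++ᴾ q)

  split : ∀ ps {a c u y qs} → Path N a (ps ++ (u , y) ∷ qs) c →
          Path N a ps u × Path N u ((u , y) ∷ qs) c
  split [] p@(step _ _ _) = [] , p
  split (_ ∷ ps) (step y∈ y∈′ p) with q , r ← split ps p = step y∈ y∈′ q , r

  rotate : ∀ {v ps u y} → (u , y) ∈ ps → Path N v ps v →
           ∃[ qs ] Path N u ((u , y) ∷ qs) u × (u , y) ∷ qs ↭ ps
  rotate {u = u} {y} u∈ps p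
    with as , bs , refl ← ∈-∃++ u∈ps
    with q , r ← split as p =
    bs ++ as , r ++ᴾ q , ++-comm ((u , y) ∷ bs) as

  -- The result is b ... a y c ... d: the first walk backwards, then y, then the second walk. As in
  -- list reversal with an accumulator, each call moves `a` to the front of the second walk, and the
  -- edge `f` that left `a` becomes the new connecting edge.
  reverse-++ᴾ : ∀ {a b c d y ps qs} → Path N a ps b → y ∈ N a → y ∈ N c → Path N c qs d →
                ∃[ rs ] Path N b rs d ×
                        map proj₁ rs ↭ b ∷ map proj₁ ps ++ map proj₁ qs ×
                        map proj₂ rs ↭ y ∷ map proj₂ ps ++ map proj₂ qs
  reverse-++ᴾ [] y∈a y∈c q = _ , step y∈a y∈c q , ↭-refl , ↭-refl
  reverse-++ᴾ {a} {b} {y = y} {ps = (_ , f) ∷ ps} (step f∈a f∈b′ p) y∈a y∈c q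
    with rs , r , V , E ← reverse-++ᴾ p f∈b′ f∈a (step y∈a y∈c q) =
    rs , r , ↭-trans V (prep b (shift a (map proj₁ ps) _)) ,
    ↭-trans E (shift y (f ∷ map proj₂ ps) _)

  -- The walk from w back to u is closed up by the detour u z x z′ w.
  bypass : ∀ {x u w z z′ qs} → Path N w qs u → Unique (z ∷ z′ ∷ map proj₂ qs) →
           z ∈ N u → z ∈ N x → z′ ∈ N x → z′ ∈ N w →
           Cycle N (x ∷ u ∷ map proj₁ qs)
  bypass q zs! z∈u z∈x z′∈x z′∈w =
    cycle (step z∈u z∈x (step z′∈x z′∈w q)) zs! (swap _ _ ↭-refl)

  -- The step u y w becomes u z x y w: y is kept, and z is the only new edge.
  insert : ∀ {x u y z v ps} → Path N v ps v → Unique (map proj₂ ps) → (u , y) ∈ ps →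
           y ∈ N x → z ∈ N x → z ∈ N u → z ∉ map proj₂ ps → Cycle N (x ∷ map proj₁ ps)
  insert {x} {u} {y} {z} p ps! u∈ps y∈x z∈x z∈u z∉ps
    with qs , step _ y∈w q , qs↭ps ← rotate u∈ps p
    = relabel x (map⁺-↭ proj₁ qs↭ps)
        (bypass q (Unique-resp-↭ (prep z (↭-sym (map⁺-↭ proj₂ qs↭ps))) (∉⇒Unique-∷ z∉ps ps!))
          z∈u z∈x y∈x y∈w)

  -- u y … u′ y′ w … u becomes x y … u′ z u … w y′ x.
  cross : ∀ {x u u′ y y′ z v ps} → Path N v ps v → Unique (map proj₂ ps) →
          (u , y) ∈ ps → (u′ , y′) ∈ ps → y ≢ y′ → y ∈ N x → y′ ∈ N x →
          z ∈ N u → z ∈ N u′ → z ∉ map proj₂ ps → Cycle N (x ∷ map proj₁ ps)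
  cross {x} {u} {u′} {y} {y′} {z} {ps = ps} p ps! u∈ps u′∈ps y≢y′ y∈x y′∈x z∈u z∈u′ z∉ps
    with qs , step _ y∈w q , qs↭ps ← rotate u∈ps p
    with ∈-resp-↭ (↭-sym qs↭ps) u′∈ps
  ... | here refl = contradiction refl y≢y′
  ... | there u′∈qs
    with as , bs , refl ← ∈-∃++ u′∈qs
    with r , step _ y′∈w′ s ← split as q
    with cs , t , V , E ← reverse-++ᴾ s y′∈w′ y′∈x [] =
    cycle (step y∈x y∈w (r ++ᴾ step z∈u′ z∈u t))
          (Unique-resp-↭ (↭-sym edges↭) (∉⇒Unique-∷ z∉ps ps!))
          vertices↭
    where
    open PermutationReasoning
    edges↭ : map proj₂ ((x , y) ∷ as ++ (u′ , z) ∷ cs) ↭ z ∷ map proj₂ ps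
    edges↭ = begin
      y ∷ map proj₂ (as ++ (u′ , z) ∷ cs)             ≡⟨ cong (y ∷_) (map-++ proj₂ as _) ⟩
      y ∷ map proj₂ as ++ z ∷ map proj₂ cs            ↭⟨ shift z (y ∷ map proj₂ as) _ ⟩
      z ∷ y ∷ map proj₂ as ++ map proj₂ cs            ↭⟨ ++⁺ˡ (z ∷ y ∷ map proj₂ as) E ⟩
      z ∷ y ∷ map proj₂ as ++ y′ ∷ map proj₂ bs ++ []
        ≡⟨ cong (λ l → z ∷ y ∷ map proj₂ as ++ y′ ∷ l) (++-identityʳ _) ⟩
      z ∷ y ∷ map proj₂ as ++ y′ ∷ map proj₂ bs       ≡⟨ cong (λ l → z ∷ y ∷ l) (map-++ proj₂ as _) ⟨
      z ∷ map proj₂ ((u , y) ∷ as ++ (u′ , y′) ∷ bs)  ↭⟨ prep z (map⁺-↭ proj₂ qs↭ps) ⟩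
      z ∷ map proj₂ ps                                ∎
    vertices↭ : map proj₁ ((x , y) ∷ as ++ (u′ , z) ∷ cs) ↭ x ∷ map proj₁ ps
    vertices↭ = begin
      x ∷ map proj₁ (as ++ (u′ , z) ∷ cs)                ≡⟨ cong (x ∷_) (map-++ proj₁ as _) ⟩
      x ∷ map proj₁ as ++ u′ ∷ map proj₁ cs              ↭⟨ ++⁺ˡ (x ∷ map proj₁ as) (prep u′ V) ⟩
      x ∷ map proj₁ as ++ u′ ∷ u ∷ map proj₁ bs ++ []
        ≡⟨ cong (λ l → x ∷ map proj₁ as ++ u′ ∷ u ∷ l) (++-identityʳ _) ⟩
      x ∷ map proj₁ as ++ u′ ∷ u ∷ map proj₁ bs          ↭⟨ ++⁺ˡ (x ∷ map proj₁ as) (swap u′ u ↭-refl) ⟩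
      x ∷ map proj₁ as ++ u ∷ u′ ∷ map proj₁ bs          ↭⟨ prep x (shift u (map proj₁ as) _) ⟩
      x ∷ u ∷ map proj₁ as ++ u′ ∷ map proj₁ bs          ≡⟨ cong (λ l → x ∷ u ∷ l) (map-++ proj₁ as _) ⟨
      x ∷ map proj₁ ((u , y) ∷ as ++ (u′ , y′) ∷ bs)     ↭⟨ prep x (map⁺-↭ proj₁ qs↭ps) ⟩
      x ∷ map proj₁ ps                                   ∎

-- Counting edges, and extending a cycle by one vertex.

module _ {X Y : Set} (_≟_ : DecidableEquality Y) (N : X → List Y) (E : List Y) (k : ℕ)
         (N! : ∀ x → Unique (N x)) (N⊆E : ∀ {x} → N x ⊆ E)
         (k≤∣N∣ : ∀ x → k ≤ length (N x)) (∣E∣+2≤2k : length E + 2 ≤ 2 * k) where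

  open DecMembership _≟_ using (_∈?_)

  N-without : X → Y → List Y
  N-without x w = filter (λ y → ¬? (y ≟ w)) (N x)

  -- At least k - 1 edges remain at x, and (k - 1) + k exceeds 2k - 2.
  ∣E∣<∣N-without∣+∣N∣ : ∀ x w u → length E < length (N-without x w) + length (N u)
  -- One is added to both sides, which avoids the truncated k - 1.
  ∣E∣<∣N-without∣+∣N∣ x w u = +-cancelʳ-≤ 1 _ _ (begin
    suc (length E) + 1                          ≡⟨ +-suc (length E) 1 ⟨
    length E + 2                                ≤⟨ ∣E∣+2≤2k ⟩
    2 * k                                       ≡⟨ cong (k +_) (+-identityʳ k) ⟩
    k + k                                       ≤⟨ +-mono-≤ k≤1+∣N-without∣ (k≤∣N∣ u) ⟩
    suc (length (N-without x w) + length (N u)) ≡⟨ +-comm 1 _ ⟩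
    length (N-without x w) + length (N u) + 1   ∎)
    where
    open ≤-Reasoning
    k≤1+∣N-without∣ : k ≤ suc (length (N-without x w))
    k≤1+∣N-without∣ = ≤-trans (k≤∣N∣ x) (length≤1+length-filter-≢ _≟_ w (N! x))

  -- The edges at x other than w compete with the edges at u for places in `E`. The second
  -- alternative records `y ≢ w`, so that y and w can serve as two distinct edges of x.
  pigeonhole-N : ∀ x w u (R : Y → Y → Set) → (∀ {y} → y ∈ N x → ∃[ z ] R y z × z ∈ E) →
                 (∃[ y ] ∃[ y′ ] ∃[ z ] y ∈ N x × y′ ∈ N x × y ≢ y′ × R y z × R y′ z) ⊎
                 (∃[ y ] ∃[ z ] y ∈ N x × y ≢ w × z ∈ N u × R y z)
  pigeonhole-N x w u R R-total
    with pigeonhole _≟_ R E (filter⁺ _ (N! x)) (N! u) N⊆E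
           (R-total ∘ proj₁ ∘ ∈-filter⁻ (λ y → ¬? (y ≟ w))) (∣E∣<∣N-without∣+∣N∣ x w u)
  ... | inj₁ (y , y′ , z , y∈ , y′∈ , rest) =
    inj₁ (y , y′ , z , proj₁ (∈-filter⁻ _ y∈) , proj₁ (∈-filter⁻ _ y′∈) , rest)
  ... | inj₂ (y , z , y∈ , z∈u , Ryz) with y∈x , y≢w ← ∈-filter⁻ (λ y → ¬? (y ≟ w)) y∈ =
    inj₂ (y , z , y∈x , y≢w , z∈u , Ryz)

  -- For `R` equality, two distinct edges cannot share a value, so the second alternative holds.
  -- Avoiding an arbitrary w expresses that x and u have two common edges.
  common : ∀ x u w → ∃[ y ] y ∈ N x × y ∈ N u × y ≢ w
  common x u w with pigeonhole-N x w u _≡_ (λ y∈x → _ , refl , N⊆E y∈x)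
  ... | inj₁ (y , y′ , z , _ , _ , y≢y′ , refl , refl) = contradiction refl y≢y′
  ... | inj₂ (y , _ , y∈x , y≢w , y∈u , refl)          = y , y∈x , y∈u , y≢w

  module _ {x v : X} {ps : List (X × Y)} (p : Path N v ps v) (ps! : Unique (map proj₂ ps))
           (∣ps∣<k : length ps < k) where

    Outside : Y → Set
    Outside z = z ∉ map proj₂ ps

    -- Rerouting y frees it for x: z is a neighbour, off the cycle, of the vertex preceding y.
    Reroute : Y → Y → Set
    Reroute y z = Outside z × (y ≡ z ⊎ ∃[ u ] (u , y) ∈ ps × z ∈ N u)

    -- The cycle uses fewer than k edges, while u has at least k.
    outside-neighbour : ∀ u → ∃[ z ] z ∈ N u × Outside z
    outside-neighbour u = length<⇒∃∉ _≟_ (N! u)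
      (subst (_< length (N u)) (sym (length-map proj₂ ps)) (<-≤-trans ∣ps∣<k (k≤∣N∣ u)))

    reroute-total : ∀ {y} → y ∈ N x → ∃[ z ] Reroute y z × z ∈ E
    reroute-total {y} y∈x with y ∈? map proj₂ ps
    ... | no y∉ps = y , (y∉ps , inj₁ refl) , N⊆E y∈x
    ... | yes y∈ps with (u , _) , u∈ps , refl ← ∈-map⁻ proj₂ y∈ps
                   with z , z∈u , z∉ps ← outside-neighbour u =
      z , (z∉ps , inj₂ (u , u∈ps , z∈u)) , N⊆E z∈u

    -- If neither edge is moved, both equal z. If exactly one is moved, the other is z itself,
    -- incident to x and to the vertex preceding the moved edge: this is insertion. If both are
    -- moved, z joins the two preceding vertices: this is crossing.
    reroute-collision : ∀ {y y′ z} → y ∈ N x → y′ ∈ N x → y ≢ y′ → Reroute y z → Reroute y′ z →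
                        Cycle N (x ∷ map proj₁ ps)
    reroute-collision _ _ y≢y′ (_ , inj₁ refl) (_ , inj₁ refl) = contradiction refl y≢y′
    reroute-collision y∈x y′∈x _ (z∉ps , inj₁ refl) (_ , inj₂ (u′ , u′∈ps , z∈u′)) =
      insert p ps! u′∈ps y′∈x y∈x z∈u′ z∉ps
    reroute-collision y∈x y′∈x _ (z∉ps , inj₂ (u , u∈ps , z∈u)) (_ , inj₁ refl) =
      insert p ps! u∈ps y∈x y′∈x z∈u z∉ps
    reroute-collision y∈x y′∈x y≢y′ (z∉ps , inj₂ (u , u∈ps , z∈u)) (_ , inj₂ (u′ , u′∈ps , z∈u′)) =
      cross p ps! u∈ps u′∈ps y≢y′ y∈x y′∈x z∈u z∈u′ z∉ps

    -- Every edge at u off the cycle is a possible rerouting of y. Hence if some other edge `f` of x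
    -- reroutes to an edge at u, then `f` collides with y; y is left out of the count to ensure that
    -- `f` differs from it.
    extend-attached : ∀ {u y} → (u , y) ∈ ps → y ∈ N x → Cycle N (x ∷ map proj₁ ps)
    extend-attached {u} {y} u∈ps y∈x with pigeonhole-N x y u Reroute reroute-total
    ... | inj₁ (_ , _ , _ , f∈x , f′∈x , f≢f′ , Rfz , Rf′z) = reroute-collision f∈x f′∈x f≢f′ Rfz Rf′z
    ... | inj₂ (_ , _ , f∈x , f≢y , z∈u , Rfz@(z∉ps , _)) =
      reroute-collision f∈x y∈x f≢y Rfz (z∉ps , inj₂ (u , u∈ps , z∈u))

  -- The first edge y, joining v and w, gives way to the detour v z x z′ w. Both z and z′ lie off
  -- the cycle because they are incident to x. Choosing z different from z′ also handles the
  -- one-vertex cycle, where w is v.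
  extend-detached : ∀ {x v p ps} → Path N v (p ∷ ps) v → Unique (map proj₂ (p ∷ ps)) →
                    (∀ {y} → y ∈ N x → y ∉ map proj₂ (p ∷ ps)) → Cycle N (x ∷ map proj₁ (p ∷ ps))
  extend-detached {x} {v} {_ , y} (step {b = w} _ _ q) (_ ∷ ps!) detached
    with z′ , z′∈x , z′∈w , _ ← common x w y
    with z , z∈x , z∈v , z≢z′ ← common x v z′ =
    bypass q
      (((λ { refl → z≢z′ refl }) ∷ ¬Any⇒All¬ _ (detached z∈x ∘ there))
        ∷ ∉⇒Unique-∷ (detached z′∈x ∘ there) ps!)
      z∈v z∈x z′∈x z′∈w

  extend : ∀ x {v vs} → Cycle N (v ∷ vs) → suc (length vs) < k → Cycle N (x ∷ v ∷ vs)
  extend x {v} {vs} (cycle {steps = []} _ _ V) _ with () ← ↭-length V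
  extend x {v} {vs} (cycle {steps = p ∷ ps} closed edges! V) vs<k
    with any? (_∈? map proj₂ (p ∷ ps)) (N x)
  ... | no detached = relabel x V (extend-detached closed edges! λ y∈x y∈ps → detached (lose y∈x y∈ps))
  ... | yes attached
    with y , y∈x , y∈ps ← find attached
    with _ , u∈ps , refl ← ∈-map⁻ proj₂ y∈ps =
    relabel x V (extend-attached closed edges! ps<k u∈ps y∈x)
    where
    ps<k : length (p ∷ ps) < k
    ps<k = subst (_< k) (trans (sym (↭-length V)) (length-map proj₁ (p ∷ ps))) vs<k

  spanning-cycle : ∀ v vs → length (v ∷ vs) ≤ k → Cycle N (v ∷ vs)
  -- The induction starts from the one-step closed walk v y v.
  spanning-cycle v [] 1≤k
    with y , y∈v , _ ← length<⇒∃∉ _≟_ {ys = []} (N! v) (≤-trans 1≤k (k≤∣N∣ v)) =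
    cycle (step y∈v y∈v []) ([] ∷ []) ↭-refl
  -- The bound on the longer list is the strict bound on the cycle through `w ∷ vs` that `extend`
  -- asks for.
  spanning-cycle v (w ∷ vs) vs≤k = extend v (spanning-cycle w vs (≤-trans (n≤1+n _) vs≤k)) vs≤k

-- Closed walks indexed modulo their length.

module _ {X Y : Set} {N : X → List Y} where

  path-source : ∀ {a ps b} → Path N a ps b → ∀ i → proj₂ (lookup ps i) ∈ N (proj₁ (lookup ps i))
  path-source (step y∈ _ _) zero    = y∈
  path-source (step _ _ p)  (suc i) = path-source p i

  path-next : ∀ {a ps b} → Path N a ps b → ∀ i j → toℕ j ≡ suc (toℕ i) →
              proj₂ (lookup ps i) ∈ N (proj₁ (lookup ps j))
  path-next (step _ y∈ (step _ _ _)) zero    (suc zero) _ = y∈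
  path-next (step _ _ p) (suc i) (suc j) eq = path-next p i j (suc-injective eq)

  path-last : ∀ {a ps b} → Path N a ps b → ∀ i → length ps ≡ suc (toℕ i) → proj₂ (lookup ps i) ∈ N b
  path-last (step _ y∈ []) zero _ = y∈
  path-last (step _ _ p) (suc i) eq = path-last p i (suc-injective eq)

toℕ-next : ∀ {k} (i : Fin (suc k)) → toℕ (next i) ≡ suc (toℕ i) % suc k
toℕ-next i = toℕ-fromℕ< _

-- Before the last position, `next` is the successor. At the last position it wraps to `zero`, and
-- the last edge leads back to the base, which is the vertex at `zero`.
closed-path-next : {X Y : Set} {N : X → List Y} {a : X} {ps : List (X × Y)} → Path N a ps a → ∀ i →
                   proj₂ (lookup ps i) ∈ N (proj₁ (lookup ps (next i)))
closed-path-next {N = N} {ps = ps@(_ ∷ qs)} p@(step _ _ _) i with m≤n⇒m<n∨m≡n (toℕ<n i)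
... | inj₁ i+1<l = path-next p i (next i) (trans (toℕ-next i) (m<n⇒m%n≡m i+1<l))
... | inj₂ i+1≡l = subst (λ j → proj₂ (lookup ps i) ∈ N (proj₁ (lookup ps j))) (sym next≡0)
                     (path-last p i (sym i+1≡l))
  where
  next≡0 : next i ≡ zero
  next≡0 = toℕ-injective (trans (toℕ-next i)
             (trans (cong (_% suc (length qs)) i+1≡l) (n%n≡0 (suc (length qs)))))

-- Translating vectors and subsets into lists.

count≡length-filter : {A : Set} {P : A → Set} (P? : Decidable P) {n : ℕ} (xs : Vec A n) →
                      count P? xs ≡ length (filter P? (Vec.toList xs))
count≡length-filter P? []       = refl
count≡length-filter P? (x ∷ xs) with does (P? x)
... | true  = cong suc (count≡length-filter P? xs)
... | false = count≡length-filter P? xs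

Unique-toList : {A : Set} {n : ℕ} {xs : Vec A n} → Vec.Unique xs → Unique (Vec.toList xs)
Unique-toList VecAllPairs.[]         = []
Unique-toList (x∉xs VecAllPairs.∷ xs!) = VecAll.toList⁺ x∉xs ∷ Unique-toList xs!

0<∣A∣⇒nonempty : ∀ {n} (A : Subset n) → 0 < ∣ A ∣ → Nonempty A
0<∣A∣⇒nonempty {n} A 0<∣A∣ = decidable-stable (Subset.nonempty? A) λ empty →
  contradiction (subst (λ B → 0 < ∣ B ∣) (Subset.Empty-unique empty) 0<∣A∣)
    (<⇒≱ (s≤s (≤-reflexive (Subset.∣⊥∣≡0 n))))

-- Berge cycles from closed walks, and the super-pancyclicity theorem.

module _ {n m : ℕ} (H : Hypergraph n m) where

  edgeList : List (Subset n)
  edgeList = Vec.toList (edges H)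

  incident : Fin n → List (Subset n)
  incident v = filter (v Subset.∈?_) edgeList

  degree≡∣incident∣ : ∀ v → degree H v ≡ length (incident v)
  degree≡∣incident∣ v = count≡length-filter (v Subset.∈?_) (edges H)

  -- Distinctness of the base vertices is carried from `vs` through the permutation. The base set is
  -- described by two inclusions, since `vs` is a list and not yet a `Subset`.
  bergeCycle : ∀ {vs} → Unique vs → Cycle incident vs →
               ∃[ ℓ ] Σ[ C ∈ BergeCycle H ℓ ]
                 (∀ x → x ∈ vs → ∃[ i ] BergeCycle.vertex C i ≡ x) ×
                 (∀ i → BergeCycle.vertex C i ∈ vs)
  bergeCycle {vs} vs! (cycle {steps = ps} closed edges! vertices↭) =
    length ps , C , covers , λ i → ∈-resp-↭ vertices↭ (∈-map⁺ proj₁ (∈-lookup i))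
    where
    source∈ : ∀ i → proj₂ (lookup ps i) ∈ edgeList × proj₁ (lookup ps i) ∈ₛ proj₂ (lookup ps i)
    source∈ i = ∈-filter⁻ _ (path-source closed i)

    C : BergeCycle H (length ps)
    C = record
      { vertex           = proj₁ ∘ lookup ps
      ; edge             = proj₂ ∘ lookup ps
      ; edge∈H           = Vec.∈-toList⁻ ∘ proj₁ ∘ source∈
      ; vertex-injective = Unique-map⇒injective proj₁ ps (Unique-resp-↭ (↭-sym vertices↭) vs!)
      ; edge-injective   = Unique-map⇒injective proj₂ ps edges!
      ; vertex∈edge      = proj₂ ∘ source∈
      ; next∈edge        = λ i →
          proj₂ (∈-filter⁻ (proj₁ (lookup ps (next i)) Subset.∈?_) {xs = edgeList}
                  (closed-path-next closed i))
      }

    covers : ∀ x → x ∈ vs → ∃[ i ] BergeCycle.vertex C i ≡ x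
    covers x x∈vs with q , q∈ps , refl ← ∈-map⁻ proj₁ (∈-resp-↭ (↭-sym vertices↭) x∈vs) =
      index q∈ps , cong proj₁ (sym (lookup-index q∈ps))

theorem7 : (n m δ : ℕ) → δ ≥ n → 2 * δ ≥ m + 2 →
    (H : Hypergraph n m) → MinDegree≥ H δ → SuperPancyclic H
theorem7 n m δ n≤δ m+2≤2δ H δ≤deg A 3≤∣A∣ =
  let ℓ , C , covers , inside = bergeCycle H (filter⁺ (Subset._∈? A) (allFin⁺ n)) A-cycle
  in ℓ , C , λ x → mk⇔ (covers x ∘ ∈-filter⁺ (Subset._∈? A) (∈-allFin x))
                       (λ { (i , refl) → proj₂ (∈-filter⁻ (Subset._∈? A) {xs = allFin n} (inside i)) })
  where
  members : List (Fin n)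
  members = filter (Subset._∈? A) (allFin n)

  -- Here δ ≥ n enters: it lets δ serve as the k of the construction.
  ∣members∣≤δ : length members ≤ δ
  ∣members∣≤δ = ≤-trans (length-filter (Subset._∈? A) (allFin n))
                  (≤-trans (≤-reflexive (length-tabulate id)) n≤δ)

  -- Stated for a variable list, so that it can be matched and the membership excludes the empty
  -- case.
  spanning : ∀ {v} vs → v ∈ vs → length vs ≤ δ → Cycle (incident H) vs
  spanning (v ∷ vs) _ = spanning-cycle (Vec.≡-dec Bool._≟_) (incident H) (edgeList H) δ
    (λ v → filter⁺ (v Subset.∈?_) (Unique-toList (distinct H)))
    (λ {v} → proj₁ ∘ ∈-filter⁻ (v Subset.∈?_))
    (λ v → subst (δ ≤_) (degree≡∣incident∣ H v) (δ≤deg v))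
    (subst (λ l → l + 2 ≤ 2 * δ) (sym (Vec.length-toList (edges H))) m+2≤2δ)
    v vs

  A-cycle : Cycle (incident H) members
  A-cycle with v , v∈A ← 0<∣A∣⇒nonempty A (≤-trans (s≤s z≤n) 3≤∣A∣) =
    spanning members (∈-filter⁺ (Subset._∈? A) (∈-allFin v) v∈A) ∣members∣≤δ
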